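{- Let $w$ be a bi-infinite square-free word over the ternary alphabet $\{0,1,2\}$. Then the following properties are equivalent: (a) $w$ contains at most $16$ distinct palindromes (including the empty word). (b) $w$ avoids overpals, i.e., no factor of $w$ is an overpal. (c) $w$ avoids the letter pattern $abcacba$.
   Context: A word is square-free if it has no factor of the form $uu$ with $u$ a nonempty word. A palindrome is a finite word equal to its reversal; a word contains a palindrome if the palindrome is one of its factors. An overpal is a word of the form $axax^Ra$, where $a$ is a single letter, $x$ is a (possibly empty) finite word, and $x^R$ is the reversal of $x$. A letter pattern is a finite word over variables $a,b,c,\dots$ in which each variable stands for one letter and different variables stand for different letters; $w$ avoids the letter pattern $abcacba$ if no factor of $w$ is obtained from $abcacba$ by substituting pairwise distinct letters of $\{0,1,2\}$ for $a,b,c$. -}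

module Defs where

open import Data.Fin using (Fin)
open import Data.Integer using (ℤ; +_; _+_)
open import Data.List using (List; []; _∷_; [_]; _++_; length; map; reverse; applyUpTo)
open import Data.List.Relation.Unary.All using (All)
open import Data.List.Relation.Unary.Unique.Propositional using (Unique)
open import Data.Nat using (ℕ; _≤_)
open import Data.Product using (∃₂; _×_)
open import Function.Definitions using (Injective)
open import Relation.Binary.PropositionalEquality using (_≡_; _≢_)
open import Relation.Nullary using (¬_)

BiInfiniteWord : Set → Set
BiInfiniteWord A = ℤ → A

Letter : Set
Letter = Fin 3

module _ {A : Set} where

  -- The finite word w(i) w(i+1) ⋯ w(i+n-1).
  window : BiInfiniteWord A → ℤ → ℕ → List A
  window w i n = applyUpTo (λ k → w (i + + k)) n

  Factor : BiInfiniteWord A → List A → Set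
  Factor w u = ∃₂ λ i n → u ≡ window w i n

  SquareFree : BiInfiniteWord A → Set
  SquareFree w = ∀ u → u ≢ [] → ¬ Factor w (u ++ u)

  Palindrome : List A → Set
  Palindrome u = u ≡ reverse u

  -- Every list of pairwise distinct palindromic factors of w has length at
  -- most m. The empty word is a palindromic factor and so is counted.
  AtMostPalindromes : ℕ → BiInfiniteWord A → Set
  AtMostPalindromes m w =
    (ps : List (List A)) → Unique ps →
    All (λ p → Palindrome p × Factor w p) ps → length ps ≤ m

  Overpal : List A → Set
  Overpal u = ∃₂ λ a x → u ≡ [ a ] ++ x ++ [ a ] ++ reverse x ++ [ a ]

  AvoidsOverpals : BiInfiniteWord A → Set
  AvoidsOverpals w = ∀ u → Overpal u → ¬ Factor w u

  -- A letter pattern is a finite word over a type V of variables.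
  AvoidsLetterPattern : {V : Set} → List V → BiInfiniteWord A → Set
  AvoidsLetterPattern {V} p w =
    (σ : V → A) → Injective _≡_ _≡_ σ → ¬ Factor w (map σ p)

data Var : Set where
  a b c : Var

abcacba : List Var
abcacba = a ∷ b ∷ c ∷ a ∷ c ∷ b ∷ a ∷ []

{-# OPTIONS --safe #-}
module Submission where

-- Square-free palindromes have odd length, and peeling off outer letters reduces
-- a palindrome to its centre. A square-free ternary palindrome of length at most 5
-- is empty, x, xyx or zxyxz: 16 words. Wrapping zxyxz in a further letter gives
-- xzxyxzx, which has no square-free extension to the left and so is not a factor,
-- or an instance of abcacba. So if abcacba is avoided, there are no palindromes
-- besides these 16, and no overpals.
--
-- Conversely, let abcacba = 0120210 be a factor. If some xyx is not, a finite
-- search over left extensions always runs into a square or a 17th palindrome.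
-- Otherwise each xyx is a factor, and so is zxyxz, as z is the only letter that
-- can stand on either side of xyx; with 0120210 this makes 17 palindromes.
-- Whether xyx is a factor is not decidable, but the goal is a negation, so
-- the case distinction may be made under a double negation.

open import Defs
open import Data.Empty using (⊥)
open import Data.Fin using (Fin; zero; suc; toℕ)
open import Data.Fin.Properties as Fin using (injective⇒≤)
open import Data.Integer using (ℤ; +_; pred) renaming (suc to sucℤ; _+_ to _+ℤ_)
open import Data.Integer.Properties as ℤ using (suc-pred)
open import Data.List
  using (List; []; _∷_; [_]; _++_; _∷ʳ_; length; lookup; map; reverse; take; drop; tails;
         applyUpTo; foldr; filter; allFin; cartesianProduct; initLast; _∷ʳ′_)
open import Data.List.Membership.DecPropositional using () renaming (_∈?_ to mem?)
open import Data.List.Membership.Propositional using (_∈_)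
open import Data.List.Membership.Propositional.Properties using (∈-lookup)
open import Data.List.Membership.Setoid.Properties using (index-injective)
open import Data.List.Properties
  using (∷-injective; ∷-injectiveʳ; ∷ʳ-injectiveˡ; ++-assoc; ++-identityʳ; length-++-≤ˡ;
         length-++-≤ʳ; length-reverse; length-map; map-applyUpTo; map-++; map-injective; map-∘;
         map-cong; map-id; reverse-map; applyUpTo-∷ʳ; unfold-reverse; reverse-++; take++drop≡id;
         ≡-dec)
open import Data.List.Relation.Binary.Pointwise using (Pointwise-≡⇒≡)
open import Data.List.Relation.Binary.Prefix.Heterogeneous using (Prefix; toView)
  renaming (_++_ to _then_)
open import Data.List.Relation.Binary.Prefix.Heterogeneous.Properties using (prefix?)
open import Data.List.Relation.Unary.All as All using (All; []; _∷_)
open import Data.List.Relation.Unary.All.Properties as All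
  using (¬Any⇒All¬; all-filter; applyUpTo⁺₂; ++⁺; map⁺)
open import Data.List.Relation.Unary.Any using (here; index)
open import Data.List.Relation.Unary.Unique.DecPropositional using (unique?)
import Data.List.Relation.Unary.Unique.Propositional.Properties as Unique
open import Data.List.Relation.Unary.Unique.Propositional using (Unique; []; _∷_)
open import Data.Nat using (ℕ; zero; suc; _≤_; z≤n; s≤s; _≤?_)
open import Data.Nat.Properties using (1+n≰n; ≤-trans; ≤-refl; module ≤-Reasoning)
open import Data.Product using (∃-syntax; _×_; _,_; proj₁; proj₂)
open import Data.Sum using (_⊎_; inj₁; inj₂)
open import Function using (_∘_)
open import Function.Bundles using (_⇔_; mk⇔)
open import Function.Definitions using (Injective)
open import Level using (0ℓ)
open import Relation.Binary.Definitions using (DecidableEquality)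
open import Relation.Binary.PropositionalEquality
  using (_≡_; _≢_; refl; sym; trans; cong; subst; setoid; module ≡-Reasoning)
open import Relation.Nullary using (¬_; Dec; yes; no; ¬?; contradiction)
open import Relation.Nullary.Decidable
  using (map′; _×-dec_; _⊎-dec_; _→-dec_; from-yes)
open import Relation.Nullary.Negation using (¬¬-map; ¬¬-Monad; contraposition)

-- Counting in duplicate-free lists, and palindromes as nested words.

i+[1+k]≡[1+i]+k : ∀ i k → i +ℤ + suc k ≡ sucℤ i +ℤ + k
i+[1+k]≡[1+i]+k i k = trans (sym (ℤ.+-assoc i (+ 1) (+ k))) (cong (_+ℤ + k) (ℤ.+-comm i (+ 1)))

module _ {A : Set} where

  lookup-injective : {xs : List A} → Unique xs → Injective _≡_ _≡_ (lookup xs)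
  lookup-injective (x∉ ∷ u) {zero}  {zero}  eq = refl
  lookup-injective (x∉ ∷ u) {zero}  {suc j} eq = contradiction eq (All.lookup x∉ (∈-lookup j))
  lookup-injective (x∉ ∷ u) {suc i} {zero}  eq =
    contradiction (sym eq) (All.lookup x∉ (∈-lookup i))
  lookup-injective (x∉ ∷ u) {suc i} {suc j} eq = cong suc (lookup-injective u eq)

  -- Pigeonhole: a position in `ys` determines the entry found there, so distinct entries of `xs`
  -- take distinct positions.
  unique∧⊆⇒length≤ : {xs ys : List A} → Unique xs → All (_∈ ys) xs → length xs ≤ length ys
  unique∧⊆⇒length≤ {xs} {ys} u xs⊆ys = injective⇒≤ position-injective
    where
    xs[_]∈ys : ∀ i → lookup xs i ∈ ys
    xs[ i ]∈ys = All.lookup xs⊆ys (∈-lookup i)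

    position-injective : Injective _≡_ _≡_ (λ i → index xs[ i ]∈ys)
    position-injective {i} {j} eq =
      lookup-injective u (index-injective (setoid A) xs[ i ]∈ys xs[ j ]∈ys eq)

  applyUpTo-cong : {f g : ℕ → A} → (∀ k → f k ≡ g k) → ∀ n → applyUpTo f n ≡ applyUpTo g n
  applyUpTo-cong f≗g zero    = refl
  applyUpTo-cong f≗g (suc n) rewrite f≗g 0 = cong (_ ∷_) (applyUpTo-cong (f≗g ∘ suc) n)

  applyUpTo-prefix : ∀ (f : ℕ → A) n xs {ys} → xs ++ ys ≡ applyUpTo f n →
                     xs ≡ applyUpTo f (length xs)
  applyUpTo-prefix f n       []       eq = refl
  applyUpTo-prefix f (suc n) (x ∷ xs) eq with refl , eq′ ← ∷-injective eq =
    cong (x ∷_) (applyUpTo-prefix (f ∘ suc) n xs eq′)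

  -- Induction on this type peels off both outer letters at once, which recursion on lists does not
  -- offer.
  data Nested : List A → Set where
    []     : Nested []
    centre : ∀ x → Nested [ x ]
    wrap   : ∀ x {u} → Nested u → Nested (x ∷ u ∷ʳ x)

  palindrome⇒nested : ∀ {p} → Palindrome p → Nested p
  palindrome⇒nested {p} = go (length p) p ≤-refl
    where
    -- The bound `n` carries the recursion, since the inner word `u` is not a structural part of
    -- `x ∷ t`.
    go : ∀ n p → length p ≤ n → Palindrome p → Nested p
    go n [] _ _ = []
    go (suc n) (x ∷ t) (s≤s t≤n) pal with initLast t
    ... | [] = centre x
    ... | u ∷ʳ′ y with refl , u∷ʳy≡ ← ∷-injective (trans pal
            (trans (unfold-reverse x (u ∷ʳ y)) (cong (_∷ʳ x) (reverse-++ u [ y ])))) =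
      wrap x (go n u (≤-trans (length-++-≤ˡ u) t≤n)
                 (∷ʳ-injectiveˡ u (reverse u) u∷ʳy≡))

  nested-around : ∀ {m} → Nested m → ∀ x → Nested (x ++ m ++ reverse x)
  nested-around {m} nest []      = subst Nested (sym (++-identityʳ m)) nest
  nested-around {m} nest (y ∷ x) =
    subst (Nested ∘ (y ∷_)) reassociate (wrap y (nested-around nest x))
    where
    open ≡-Reasoning
    reassociate : (x ++ m ++ reverse x) ∷ʳ y ≡ x ++ m ++ reverse (y ∷ x)
    reassociate = begin
      (x ++ m ++ reverse x) ∷ʳ y  ≡⟨ ++-assoc x (m ++ reverse x) [ y ] ⟩
      x ++ (m ++ reverse x) ∷ʳ y  ≡⟨ cong (x ++_) (++-assoc m (reverse x) [ y ]) ⟩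
      x ++ m ++ reverse x ∷ʳ y    ≡⟨ cong (λ r → x ++ m ++ r) (sym (unfold-reverse y x)) ⟩
      x ++ m ++ reverse (y ∷ x)   ∎

  -- Regroup the overpal as a middle letter `y` between `y ∷ x` and the reversal of `y ∷ x`.
  overpal⇒nested : ∀ {u} → Overpal u → Nested u
  overpal⇒nested (y , x , refl) =
    subst (λ r → Nested (y ∷ x ++ y ∷ r)) (unfold-reverse y x) (nested-around (centre y) (y ∷ x))

-- Factors of a bi-infinite word.

module FactorProperties {A : Set} (w : BiInfiniteWord A) where

  window-suc : ∀ i n → window w i (suc n) ≡ w i ∷ window w (sucℤ i) n
  window-suc i n
    rewrite ℤ.+-identityʳ i
          | applyUpTo-cong {f = λ k → w (i +ℤ + suc k)} (cong w ∘ i+[1+k]≡[1+i]+k i) n = refl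

  factor-[] : Factor w []
  factor-[] = + 0 , 0 , refl

  factor-++ˡ : ∀ xs {ys} → Factor w (xs ++ ys) → Factor w xs
  factor-++ˡ xs (i , n , eq) = i , length xs , applyUpTo-prefix _ n xs eq

  factor-tail : ∀ {x xs} → Factor w (x ∷ xs) → Factor w xs
  factor-tail (i , suc n , eq) = sucℤ i , n , ∷-injectiveʳ (trans eq (window-suc i n))

  extendˡ : ∀ {u} → Factor w u → ∃[ x ] Factor w (x ∷ u)
  extendˡ (i , n , refl) = w (pred i) , pred i , suc n ,
    sym (trans (window-suc (pred i) n)
               (cong (λ j → w (pred i) ∷ window w j n) (suc-pred i)))

  extendʳ : ∀ {u} → Factor w u → ∃[ x ] Factor w (u ∷ʳ x)
  extendʳ (i , n , refl) = w (i +ℤ + n) , i , suc n , applyUpTo-∷ʳ _ n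

-- Transport along a relabelling of the letters.

module Relabelling {A B : Set} (w : BiInfiniteWord A)
                   (τ : A → B) (σ : B → A) (σ∘τ≗id : ∀ x → σ (τ x) ≡ x) where

  factor-relabel⁺ : ∀ {u} → Factor w u → Factor (τ ∘ w) (map τ u)
  factor-relabel⁺ (i , n , refl) = i , n , map-applyUpTo _ τ n

  factor-relabel⁻ : ∀ {u} → Factor (τ ∘ w) u → Factor w (map σ u)
  factor-relabel⁻ (i , n , refl) =
    i , n , trans (map-applyUpTo _ σ n) (applyUpTo-cong (λ _ → σ∘τ≗id _) n)

  squareFree-relabel : SquareFree w → SquareFree (τ ∘ w)
  squareFree-relabel sf []        u≢[] _   = u≢[] refl
  squareFree-relabel sf u@(_ ∷ _) _    fac =
    sf (map σ u) (λ ()) (subst (Factor w) (map-++ σ u u) (factor-relabel⁻ fac))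

  atMostPalindromes-relabel : ∀ {m} → Injective _≡_ _≡_ σ →
                              AtMostPalindromes m w → AtMostPalindromes m (τ ∘ w)
  atMostPalindromes-relabel σ-injective most ps unique pals =
    subst (_≤ _) (length-map (map σ) ps)
      (most (map (map σ) ps) (Unique.map⁺ (map-injective σ-injective) unique)
        (All.map⁺ (All.map (λ {u} (pal , fac) →
          trans (cong (map σ) pal) (reverse-map σ u) , factor-relabel⁻ fac) pals)))

-- Decidable tests on finite ternary words.

Word : Set
Word = List Letter

letters : Word
letters = allFin 3

_≟ʷ_ : DecidableEquality Word
_≟ʷ_ = ≡-dec Fin._≟_

palindrome? : (u : Word) → Dec (Palindrome u)
palindrome? u = u ≟ʷ reverse u

_∈?_ : (u : Word) (us : List Word) → Dec (u ∈ us)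
_∈?_ = mem? _≟ʷ_

BeginsWith : Word → Word → Set
BeginsWith v u = Prefix _≡_ u v

beginsWith? : ∀ v u → Dec (BeginsWith v u)
beginsWith? v u = prefix? Fin._≟_ u v

-- The repeated half is x ∷ take k xs, so k is its length minus one.
BeginsWithSquare : Word → Set
BeginsWithSquare []       = ⊥
BeginsWithSquare (x ∷ xs) =
  ∃[ k ] BeginsWith (drop (toℕ {length xs} k) xs) (x ∷ take (toℕ k) xs)

beginsWithSquare? : ∀ v → Dec (BeginsWithSquare v)
beginsWithSquare? []       = no λ ()
beginsWithSquare? (x ∷ xs) = Fin.any? λ k → beginsWith? _ _

module _ (w : BiInfiniteWord Letter) where

  open FactorProperties w

  factor-beginning : ∀ {u v} → BeginsWith v u → Factor w v → Factor w u
  factor-beginning {u} beg fac with toView beg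
  ... | pw then ds with refl ← Pointwise-≡⇒≡ pw = factor-++ˡ u fac

  squareFree⇒¬beginsWithSquare : SquareFree w → ∀ v → Factor w v → ¬ BeginsWithSquare v
  squareFree⇒¬beginsWithSquare sf (x ∷ xs) fac (k , beg)
    with drop (toℕ k) xs in eq | toView beg
  ... | _ | pw then ds with refl ← Pointwise-≡⇒≡ pw =
    sf u (λ ()) (factor-++ˡ (u ++ u) (subst (Factor w) square++rest fac))
    where
    open ≡-Reasoning
    u = x ∷ take (toℕ k) xs
    square++rest : x ∷ xs ≡ (u ++ u) ++ ds
    square++rest = begin
      x ∷ xs                   ≡⟨ cong (x ∷_) (sym (take++drop≡id (toℕ k) xs)) ⟩
      u ++ drop (toℕ k) xs     ≡⟨ cong (u ++_) eq ⟩
      u ++ u ++ ds             ≡⟨ sym (++-assoc u u ds) ⟩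
      (u ++ u) ++ ds           ∎

-- The 16 short palindromes and the instances of `abcacba`.

Distinct : Letter × Letter × Letter → Set
Distinct (x , y , z) = x ≢ y × x ≢ z × y ≢ z

distinct? : ∀ t → Dec (Distinct t)
distinct? (x , y , z) = ¬? (x Fin.≟ y) ×-dec ¬? (x Fin.≟ z) ×-dec ¬? (y Fin.≟ z)

distinctTriples : List (Letter × Letter × Letter)
distinctTriples = filter distinct? (cartesianProduct letters (cartesianProduct letters letters))

distinctTriples-distinct : All Distinct distinctTriples
distinctTriples-distinct =
  all-filter distinct? (cartesianProduct letters (cartesianProduct letters letters))

xyx zxyxz : Letter × Letter × Letter → Word
xyx   (x , y , z) = x ∷ y ∷ x ∷ []
zxyxz (x , y , z) = z ∷ x ∷ y ∷ x ∷ z ∷ []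

-- The four groups contribute 1 + 3 + 6 + 6 = 16 words.
shortPalindromes : List Word
shortPalindromes =
  [] ∷ map [_] letters ++ map xyx distinctTriples ++ map zxyxz distinctTriples

-- Triples stand in for functions on `Var`, so that being an instance of the pattern is decided by a
-- finite search.
substitution : Letter × Letter × Letter → Var → Letter
substitution (x , y , z) a = x
substitution (x , y , z) b = y
substitution (x , y , z) c = z

substitution-injective : ∀ t → Distinct t → Injective _≡_ _≡_ (substitution t)
substitution-injective t (x≢y , x≢z , y≢z) {a} {a} eq = refl
substitution-injective t (x≢y , x≢z , y≢z) {a} {b} eq = contradiction eq x≢y
substitution-injective t (x≢y , x≢z , y≢z) {a} {c} eq = contradiction eq x≢z
substitution-injective t (x≢y , x≢z , y≢z) {b} {a} eq = contradiction (sym eq) x≢y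
substitution-injective t (x≢y , x≢z , y≢z) {b} {b} eq = refl
substitution-injective t (x≢y , x≢z , y≢z) {b} {c} eq = contradiction eq y≢z
substitution-injective t (x≢y , x≢z , y≢z) {c} {a} eq = contradiction (sym eq) x≢z
substitution-injective t (x≢y , x≢z , y≢z) {c} {b} eq = contradiction (sym eq) y≢z
substitution-injective t (x≢y , x≢z , y≢z) {c} {c} eq = refl

xyzxzyx : Letter × Letter × Letter → Word
xyzxzyx t = map (substitution t) abcacba

IsPattern : Word → Set
IsPattern v = ∃[ t ] Distinct t × v ≡ xyzxzyx t

isPattern? : ∀ v → Dec (IsPattern v)
isPattern? v = map′ (λ (x , y , z , p) → (x , y , z) , p) (λ ((x , y , z) , p) → x , y , z , p)
  (Fin.any? λ x → Fin.any? λ y → Fin.any? λ z →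
    distinct? (x , y , z) ×-dec v ≟ʷ xyzxzyx (x , y , z))

-- The last alternative disposes of xzxyxzx, which is square-free but has no
-- square-free extension to the left.
ShortOrForbidden : Word → Set
ShortOrForbidden v =
  v ∈ shortPalindromes ⊎ BeginsWithSquare v ⊎ IsPattern v ⊎ (∀ y → BeginsWithSquare (y ∷ v))

shortOrForbidden? : ∀ v → Dec (ShortOrForbidden v)
shortOrForbidden? v =
  v ∈? shortPalindromes ⊎-dec beginsWithSquare? v ⊎-dec isPattern? v ⊎-dec
  Fin.all? λ y → beginsWithSquare? (y ∷ v)

Wrappable : Word → Set
Wrappable u = ∀ x → ShortOrForbidden (x ∷ u ∷ʳ x)

wrappable? : ∀ u → Dec (Wrappable u)
wrappable? u = Fin.all? λ x → shortOrForbidden? (x ∷ u ∷ʳ x)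

abstract

  singleton-short : ∀ x → [ x ] ∈ shortPalindromes
  singleton-short = from-yes (Fin.all? λ x → [ x ] ∈? shortPalindromes)

  length-shortPalindromes : All (λ p → length p ≤ 5) shortPalindromes
  length-shortPalindromes = from-yes (All.all? (λ p → length p ≤? 5) shortPalindromes)

  -- The induction step of the classification as a finite check: one more layer around a listed word
  -- gives a listed word or one that cannot occur.
  shortPalindromes-wrappable : All Wrappable shortPalindromes
  shortPalindromes-wrappable = from-yes (All.all? wrappable? shortPalindromes)

-- Avoiding `abcacba` leaves 16 palindromes and no overpals.

module _ (w : BiInfiniteWord Letter) (sf : SquareFree w) where

  open FactorProperties w

  module _ (avoids : AvoidsLetterPattern abcacba w) where

    shortOrForbiddenFactor-short : ∀ {v} → ShortOrForbidden v → Factor w v → v ∈ shortPalindromes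
    shortOrForbiddenFactor-short (inj₁ short) fac = short
    shortOrForbiddenFactor-short (inj₂ (inj₁ square)) fac =
      contradiction square (squareFree⇒¬beginsWithSquare w sf _ fac)
    shortOrForbiddenFactor-short (inj₂ (inj₂ (inj₁ (t , distinct , v≡)))) fac =
      contradiction (subst (Factor w) v≡ fac) (avoids _ (substitution-injective t distinct))
    shortOrForbiddenFactor-short (inj₂ (inj₂ (inj₂ squares))) fac with y , fac′ ← extendˡ fac =
      contradiction (squares y) (squareFree⇒¬beginsWithSquare w sf _ fac′)

    -- The core of a nested factor is again a factor, hence listed by induction, and the finite
    -- check covers the outer layer.
    nestedFactor-short : ∀ {p} → Nested p → Factor w p → p ∈ shortPalindromes
    nestedFactor-short []                _   = here refl
    nestedFactor-short (centre x)        _   = singleton-short x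
    nestedFactor-short (wrap x {u} nest) fac = shortOrForbiddenFactor-short
      (All.lookup shortPalindromes-wrappable
        (nestedFactor-short nest (factor-++ˡ u (factor-tail fac))) x) fac

    avoidsPattern⇒atMost16 : AtMostPalindromes 16 w
    avoidsPattern⇒atMost16 ps unique pals = unique∧⊆⇒length≤ {ys = shortPalindromes} unique
      (All.map (λ (pal , fac) → nestedFactor-short (palindrome⇒nested pal) fac) pals)

    avoidsPattern⇒avoidsOverpals : AvoidsOverpals w
    -- Overpals with at most one letter in `x` begin with a square: `pp` here, `pqpq` in the next
    -- clause. A longer `x` gives a palindrome too long to be listed.
    avoidsPattern⇒avoidsOverpals u (p , [] , refl) fac =
      sf [ p ] (λ ()) (factor-++ˡ (p ∷ p ∷ []) fac)
    avoidsPattern⇒avoidsOverpals u (p , q ∷ [] , refl) fac =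
      sf (p ∷ q ∷ []) (λ ()) (factor-++ˡ (p ∷ q ∷ p ∷ q ∷ []) fac)
    avoidsPattern⇒avoidsOverpals u o@(p , q ∷ r ∷ x , refl) fac = too-long
      (All.lookup length-shortPalindromes
        (nestedFactor-short (overpal⇒nested o) fac))
      where
      open ≤-Reasoning
      y = q ∷ r ∷ x
      too-long : ¬ (length (p ∷ y ++ p ∷ reverse y ++ [ p ]) ≤ 5)
      -- `p`, `q`, `r` account for three letters, and the second `p` with `reverse y` for at least
      -- three more, so the length is at least 6.
      too-long le = 1+n≰n (≤-trans (s≤s (s≤s (s≤s (begin
        3                                        ≤⟨ s≤s (s≤s (s≤s z≤n)) ⟩
        suc (length y)                           ≡⟨ cong suc (length-reverse y) ⟨
        suc (length (reverse y))                 ≤⟨ s≤s (length-++-≤ˡ (reverse y)) ⟩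
        length (p ∷ reverse y ++ [ p ])          ≤⟨ length-++-≤ʳ _ {x} ⟩
        length (x ++ p ∷ reverse y ++ [ p ])     ∎)))) le)

-- Search by left extension, recording palindromes.

record-palindrome : Word → List Word → List Word
record-palindrome p ps with palindrome? p ×-dec ¬? (p ∈? ps)
... | yes _ = p ∷ ps
... | no  _ = ps

beginnings : Word → List Word
beginnings u = applyUpTo (λ k → take (suc k) u) (length u)

record-beginnings : Word → List Word → List Word
record-beginnings u ps = foldr record-palindrome ps (beginnings u)

-- A certificate that u is not a factor of a square-free word that avoids bad
-- and has at most 16 palindromes: ps collects the palindromes met while u is
-- extended to the left, so only those beginning at the new letter are added.
Refuted : Word → ℕ → Word → List Word → Set
Refuted bad zero    u ps = ⊥
Refuted bad (suc n) u ps =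
  17 ≤ length ps ⊎ BeginsWithSquare u ⊎ BeginsWith u bad ⊎
  (∀ x → Refuted bad n (x ∷ u) (record-beginnings (x ∷ u) ps))

refuted? : ∀ bad n u ps → Dec (Refuted bad n u ps)
refuted? bad zero    u ps = no λ ()
refuted? bad (suc n) u ps =
  17 ≤? length ps ⊎-dec beginsWithSquare? u ⊎-dec beginsWith? u bad ⊎-dec
  Fin.all? λ x → refuted? bad n (x ∷ u) (record-beginnings (x ∷ u) ps)

-- Each nonempty factor begins some suffix, so all palindromic factors of `u` are collected; the
-- starting list supplies the empty word.
initialPalindromes : Word → List Word
initialPalindromes u = foldr record-beginnings [ [] ] (tails u)

module _ (w : BiInfiniteWord Letter) where

  open FactorProperties w

  Recorded : List Word → Set
  Recorded ps = Unique ps × All (λ p → Palindrome p × Factor w p) ps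

  recorded-palindrome : ∀ {p ps} → Factor w p → Recorded ps → Recorded (record-palindrome p ps)
  recorded-palindrome {p} {ps} fac (unique , pals) with palindrome? p ×-dec ¬? (p ∈? ps)
  ... | yes (pal , p∉ps) = (¬Any⇒All¬ ps p∉ps ∷ unique) , ((pal , fac) ∷ pals)
  ... | no  _            = unique , pals

  recorded-foldr : ∀ {us ps} → All (Factor w) us → Recorded ps →
                   Recorded (foldr record-palindrome ps us)
  recorded-foldr []           rec = rec
  recorded-foldr (fac ∷ facs) rec = recorded-palindrome fac (recorded-foldr facs rec)

  recorded-beginnings : ∀ {u ps} → Factor w u → Recorded ps → Recorded (record-beginnings u ps)
  recorded-beginnings {u} fac = recorded-foldr (applyUpTo⁺₂ _ (length u) λ k →
    factor-++ˡ (take (suc k) u) (subst (Factor w) (sym (take++drop≡id (suc k) u)) fac))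

  recorded-initial : ∀ u → Factor w u → Recorded (initialPalindromes u)
  recorded-initial []      fac = ([] ∷ []) , ((refl , fac) ∷ [])
  recorded-initial (x ∷ u) fac = recorded-beginnings fac (recorded-initial u (factor-tail fac))

  -- Induction on the depth. At a branching, the letter that actually precedes the occurrence in `w`
  -- selects the subtree; `Recorded` makes a list of 17 contradict the palindrome bound.
  refuted-sound : SquareFree w → AtMostPalindromes 16 w → ∀ {bad} → ¬ Factor w bad →
                  ∀ n {u ps} → Refuted bad n u ps → Factor w u → ¬ Recorded ps
  refuted-sound sf most no-bad (suc n) (inj₁ 17≤) fac (unique , pals) =
    1+n≰n (≤-trans 17≤ (most _ unique pals))
  refuted-sound sf most no-bad (suc n) (inj₂ (inj₁ square)) fac rec =
    squareFree⇒¬beginsWithSquare w sf _ fac square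
  refuted-sound sf most no-bad (suc n) (inj₂ (inj₂ (inj₁ beg))) fac rec =
    no-bad (factor-beginning w beg fac)
  refuted-sound sf most no-bad (suc n) (inj₂ (inj₂ (inj₂ all))) fac rec
    with x , fac′ ← extendˡ fac =
    refuted-sound sf most no-bad n (all x) fac′ (recorded-beginnings fac′ rec)

-- The factor 0120210 forces 17 palindromes.

pattern₀ : Word
pattern₀ = xyzxzyx (zero , suc zero , suc (suc zero))

-- 60 exceeds the depth of the search trees.
Unavoidable : Word → Set
Unavoidable u =
  u ∈ initialPalindromes pattern₀ ⊎ Refuted u 60 pattern₀ (initialPalindromes pattern₀)

unavoidable? : ∀ u → Dec (Unavoidable u)
unavoidable? u =
  u ∈? initialPalindromes pattern₀ ⊎-dec refuted? u 60 pattern₀ (initialPalindromes pattern₀)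

abstract

  letter-unavoidable : ∀ x → [ x ] ∈ initialPalindromes pattern₀
  letter-unavoidable = from-yes (Fin.all? λ x → [ x ] ∈? initialPalindromes pattern₀)

  -- Of the six words, only 202 lies inside 0120210; the other five rely on the search.
  xyx-unavoidable : All (Unavoidable ∘ xyx) distinctTriples
  xyx-unavoidable = from-yes (All.all? (unavoidable? ∘ xyx) distinctTriples)

  third-letter : ∀ x y z l → Distinct (x , y , z) → l ≢ x → l ≢ y → l ≡ z
  third-letter = from-yes (Fin.all? λ x → Fin.all? λ y → Fin.all? λ z → Fin.all? λ l →
    distinct? (x , y , z) →-dec ¬? (l Fin.≟ x) →-dec ¬? (l Fin.≟ y) →-dec l Fin.≟ z)

  pattern₀∷shortPalindromes-unique : Unique (pattern₀ ∷ shortPalindromes)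
  pattern₀∷shortPalindromes-unique = from-yes (unique? _≟ʷ_ (pattern₀ ∷ shortPalindromes))

  pattern₀∷shortPalindromes-palindromes : All Palindrome (pattern₀ ∷ shortPalindromes)
  pattern₀∷shortPalindromes-palindromes =
    from-yes (All.all? palindrome? (pattern₀ ∷ shortPalindromes))

module _ (w : BiInfiniteWord Letter) (sf : SquareFree w) where

  open FactorProperties w

  -- Next to `xyx`, the letter `x` would create `xx`, and `y` would create `yxyx` on the left or
  -- `xyxy` on the right.
  factor-xyx⇒zxyxz : ∀ t → Distinct t → Factor w (xyx t) → Factor w (zxyxz t)
  factor-xyx⇒zxyxz (x , y , z) distinct fac
    with l , facˡ ← extendˡ fac
    with refl ← third-letter x y z l distinct
      (λ { refl → sf [ x ] (λ ()) (factor-++ˡ (x ∷ x ∷ []) facˡ) })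
      (λ { refl → sf (y ∷ x ∷ []) (λ ()) facˡ })
    with r , facʳ ← extendʳ facˡ
    with refl ← third-letter x y z r distinct
      (λ { refl → sf [ x ] (λ ()) (factor-tail (factor-tail (factor-tail facʳ))) })
      (λ { refl → sf (x ∷ y ∷ []) (λ ()) (factor-tail facʳ) }) = facʳ

  module _ (most : AtMostPalindromes 16 w) (fac : Factor w pattern₀) where

    private
      recorded : Recorded w (initialPalindromes pattern₀)
      recorded = recorded-initial w pattern₀ fac

    factor-initial : ∀ {u} → u ∈ initialPalindromes pattern₀ → Factor w u
    factor-initial u∈ = proj₂ (All.lookup (proj₂ recorded) u∈)

    unavoidable⇒¬¬factor : ∀ {u} → Unavoidable u → ¬ ¬ Factor w u
    unavoidable⇒¬¬factor (inj₁ u∈)      no-u = no-u (factor-initial u∈)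
    unavoidable⇒¬¬factor (inj₂ refuted) no-u =
      refuted-sound w sf most no-u 60 {pattern₀} {initialPalindromes pattern₀} refuted fac recorded

    ¬¬factor-shortPalindromes : All (λ p → ¬ ¬ Factor w p) shortPalindromes
    ¬¬factor-shortPalindromes =
      contradiction factor-[] ∷
      ++⁺ {xs = map [_] letters}
        (map⁺ (All.universal (λ x → contradiction (factor-initial (letter-unavoidable x))) letters))
        (++⁺ (map⁺ ¬¬factor-xyx)
             (map⁺ (All.zipWith (λ {t} (d , ¬¬f) → ¬¬-map (factor-xyx⇒zxyxz t d) ¬¬f)
                     (distinctTriples-distinct , ¬¬factor-xyx))))
      where
      ¬¬factor-xyx : All (λ t → ¬ ¬ Factor w (xyx t)) distinctTriples
      ¬¬factor-xyx = All.map unavoidable⇒¬¬factor xyx-unavoidable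

    atMost16∧pattern₀⇒⊥ : ⊥
    -- Finitely many double negations merge into one, which the goal `⊥` absorbs; all 17 factors are
    -- then available together.
    atMost16∧pattern₀⇒⊥ = All.sequenceM 0ℓ ¬¬-Monad ¬¬factor-shortPalindromes λ short →
      1+n≰n (most _ pattern₀∷shortPalindromes-unique
        (All.zip (pattern₀∷shortPalindromes-palindromes , (fac ∷ short))))

-- Reduction of any instance to 0120210, and the equivalences.

atMost16⇒avoidsPattern : (w : BiInfiniteWord Letter) → SquareFree w →
  AtMostPalindromes 16 w → AvoidsLetterPattern abcacba w
-- The substitution amounts to a permutation `ρ` of the letters. Applying its inverse `τ` to `w`
-- turns the instance into `pattern₀` and preserves square-freeness and the palindrome bound.
atMost16⇒avoidsPattern w sf most σ σ-injective fac = atMost16∧pattern₀⇒⊥ (τ ∘ w)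
  (squareFree-relabel sf) (atMostPalindromes-relabel ρ-injective most)
  (subst (Factor (τ ∘ w)) τρ-pattern₀ (factor-relabel⁺ fac))
  where
  variable-of : Letter → Var
  variable-of zero             = a
  variable-of (suc zero)       = b
  variable-of (suc (suc zero)) = c

  variable-of-injective : Injective _≡_ _≡_ variable-of
  variable-of-injective {zero}           {zero}           _ = refl
  variable-of-injective {suc zero}       {suc zero}       _ = refl
  variable-of-injective {suc (suc zero)} {suc (suc zero)} _ = refl
  variable-of-injective {zero}           {suc zero}       ()
  variable-of-injective {zero}           {suc (suc zero)} ()
  variable-of-injective {suc zero}       {suc (suc zero)} ()

  ρ : Letter → Letter
  ρ = σ ∘ variable-of

  ρ-injective : Injective _≡_ _≡_ ρ
  ρ-injective = variable-of-injective ∘ σ-injective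

  ρ-distinct : Distinct (ρ zero , ρ (suc zero) , ρ (suc (suc zero)))
  ρ-distinct = contraposition ρ-injective (λ ()) , contraposition ρ-injective (λ ()) ,
               contraposition ρ-injective (λ ())

  -- Three distinct values exhaust the alphabet; the preimage found here defines `τ`.
  ρ-surjective : ∀ l → ∃[ k ] ρ k ≡ l
  ρ-surjective l with l Fin.≟ ρ zero | l Fin.≟ ρ (suc zero)
  ... | yes l≡ | _      = zero , sym l≡
  ... | no _   | yes l≡ = suc zero , sym l≡
  ... | no l≢₀ | no l≢₁ = suc (suc zero) , sym (third-letter _ _ _ l ρ-distinct l≢₀ l≢₁)

  τ : Letter → Letter
  τ = proj₁ ∘ ρ-surjective

  open Relabelling w τ ρ (proj₂ ∘ ρ-surjective)

  τρ-pattern₀ : map τ (map ρ pattern₀) ≡ pattern₀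
  τρ-pattern₀ = trans (sym (map-∘ {g = τ} {f = ρ} pattern₀))
    (trans (map-cong (λ x → ρ-injective (proj₂ (ρ-surjective (ρ x)))) pattern₀) (map-id pattern₀))

-- The pattern `abcacba` is the overpal with `x` equal to `bc`.
avoidsOverpals⇒avoidsPattern :
  (w : BiInfiniteWord Letter) → AvoidsOverpals w → AvoidsLetterPattern abcacba w
avoidsOverpals⇒avoidsPattern w avoids σ _ = avoids _ (σ a , σ b ∷ σ c ∷ [] , refl)

lemma15 : (w : BiInfiniteWord Letter) → SquareFree w →
    (AtMostPalindromes 16 w ⇔ AvoidsOverpals w) ×
    (AvoidsOverpals w ⇔ AvoidsLetterPattern abcacba w)
lemma15 w sf =
  -- Both directions between (a) and (b) pass through (c).
  mk⇔ (avoidsPattern⇒avoidsOverpals w sf ∘ atMost16⇒avoidsPattern w sf)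
      (avoidsPattern⇒atMost16 w sf ∘ avoidsOverpals⇒avoidsPattern w) ,
  mk⇔ (avoidsOverpals⇒avoidsPattern w) (avoidsPattern⇒avoidsOverpals w sf)
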